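{- Let $\mathbb{F}$ be a finite field. Then its multiplicative group $\mathbb{F}^{*}=\mathbb{F}\setminus\{0\}$ is cyclic. -}

module Defs where

open import Algebra.Bundles using (CommutativeRing; Group)
import Algebra.Definitions as AlgebraicDefinitions
import Algebra.Definitions.RawMonoid as RawMonoidPowers
open import Data.Fin.Base using (Fin)
open import Data.Integer.Base using (ℤ; +_; -[1+_])
open import Data.Nat.Base using (suc)
open import Data.Product.Base using (∃-syntax; _,_; proj₁; proj₂)
open import Function.Base using (_on_)
open import Function.Bundles using (Bijection)
open import Level using (Level; _⊔_) renaming (suc to lsuc)
open import Relation.Binary.Bundles using (Setoid)
import Relation.Binary.Construct.On as On
import Relation.Binary.PropositionalEquality as ≡
import Relation.Binary.Reasoning.Setoid as SetoidReasoning
open import Relation.Nullary.Negation using (¬_)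

private
  variable
    c ℓ : Level

-- The library has no plain notion of field: its `HeytingField` carries an
-- apartness relation as additional data.
record Field c ℓ : Set (lsuc (c ⊔ ℓ)) where
  field
    commutativeRing : CommutativeRing c ℓ

  open CommutativeRing commutativeRing public
  open AlgebraicDefinitions _≈_ using (Invertible)

  field
    0≉1           : ¬ (0# ≈ 1#)
    ≉0⇒invertible : ∀ x → ¬ (x ≈ 0#) → Invertible 1# _*_ x

Finite : Setoid c ℓ → Set (c ⊔ ℓ)
Finite S = ∃[ n ] Bijection S (≡.setoid (Fin n))

module _ (F : Field c ℓ) where
  open Field F
  open SetoidReasoning setoid

  private
    NonZero : Set (c ⊔ ℓ)
    NonZero = ∃[ x ] ¬ (x ≈ 0#)

    cancelˡ : ∀ {u x} y → u * x ≈ 1# → u * (x * y) ≈ y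
    cancelˡ {u} {x} y ux≈1 = begin
      u * (x * y)  ≈⟨ *-assoc u x y ⟨
      (u * x) * y  ≈⟨ *-congʳ ux≈1 ⟩
      1# * y       ≈⟨ *-identityˡ y ⟩
      y            ∎

    mul : NonZero → NonZero → NonZero
    mul (x , x≉0) (y , y≉0) = x * y , λ xy≈0 →
      let (u , ux≈1 , _) = ≉0⇒invertible x x≉0 in
      y≉0 (begin
        y            ≈⟨ cancelˡ y ux≈1 ⟨
        u * (x * y)  ≈⟨ *-congˡ xy≈0 ⟩
        u * 0#       ≈⟨ zeroʳ u ⟩
        0#           ∎)

    one : NonZero
    one = 1# , λ 1≈0 → 0≉1 (sym 1≈0)

    inv : NonZero → NonZero
    inv (x , x≉0) =
      let (u , ux≈1 , _) = ≉0⇒invertible x x≉0 in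
      u , λ u≈0 → 0≉1 (begin
        0#      ≈⟨ zeroˡ x ⟨
        0# * x  ≈⟨ *-congʳ u≈0 ⟨
        u * x   ≈⟨ ux≈1 ⟩
        1#      ∎)

    inv-inverseˡ : ∀ a → proj₁ (inv a) * proj₁ a ≈ 1#
    inv-inverseˡ (x , x≉0) = proj₁ (proj₂ (≉0⇒invertible x x≉0))

    inv-inverseʳ : ∀ a → proj₁ a * proj₁ (inv a) ≈ 1#
    inv-inverseʳ (x , x≉0) = proj₂ (proj₂ (≉0⇒invertible x x≉0))

    inv-cong : ∀ a b → proj₁ a ≈ proj₁ b → proj₁ (inv a) ≈ proj₁ (inv b)
    inv-cong a@(x , _) b@(y , _) x≈y = begin
      u            ≈⟨ *-identityʳ u ⟨
      u * 1#       ≈⟨ *-congˡ (inv-inverseʳ b) ⟨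
      u * (y * v)  ≈⟨ *-congˡ (*-congʳ x≈y) ⟨
      u * (x * v)  ≈⟨ cancelˡ v (inv-inverseˡ a) ⟩
      v            ∎
      where
      u = proj₁ (inv a)
      v = proj₁ (inv b)

  -- Elements are pairs of x with a proof that x is nonzero; equality compares
  -- only the first components.
  multiplicativeGroup : Group (c ⊔ ℓ) ℓ
  multiplicativeGroup = record
    { Carrier = NonZero
    ; _≈_     = _≈_ on proj₁
    ; _∙_     = mul
    ; ε       = one
    ; _⁻¹     = inv
    ; isGroup = record
      { isMonoid = record
        { isSemigroup = record
          { isMagma = record
            { isEquivalence = On.isEquivalence proj₁ isEquivalence
            ; ∙-cong        = *-cong
            }
          ; assoc = λ (x , _) (y , _) (z , _) → *-assoc x y z
          }
        ; identity = (λ (x , _) → *-identityˡ x) , (λ (x , _) → *-identityʳ x)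
        }
      ; inverse = inv-inverseˡ , inv-inverseʳ
      ; ⁻¹-cong = λ {a} {b} → inv-cong a b
      }
    }

module _ (G : Group c ℓ) where
  open Group G
  -- In the library `n × g` is the n-fold product of g with itself.
  open RawMonoidPowers rawMonoid using (_×_)

  power : Carrier → ℤ → Carrier
  power g (+ n)    = n × g
  power g -[1+ n ] = (suc n × g) ⁻¹

  Cyclic : Set (c ⊔ ℓ)
  Cyclic = ∃[ g ] ∀ x → ∃[ k ] power g k ≈ x

{-# OPTIONS --safe #-}
module Submission where

-- If g has order a and y ^ a ≠ 1 for some y, then the order b of y does not divide
-- a, so there are coprime d ∣ a and e ∣ b with d e > a, and hence an element of
-- order d e. In a finite abelian group orders are bounded, so some g of order m
-- satisfies y ^ m = 1 for all y. In a field X ^ m − 1 has at most m roots, and the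
-- m distinct powers of g already are roots.

open import Defs

open import Algebra.Bundles using (AbelianGroup; CommutativeSemiring; Group)
import Algebra.Properties.CommutativeMonoid.Mult as Powers
import Algebra.Properties.Group as GroupProperties
import Algebra.Properties.Monoid.Mult as MonoidPowers
import Algebra.Solver.Ring.NaturalCoefficients.Default as SemiringSolver
open import Data.Fin.Base as Fin using (Fin; toℕ; punchIn; punchOut)
import Data.Fin.Properties as Fin
open import Data.Integer.Base using (+_)
open import Data.List.Base using ([]; _∷_)
open import Data.List.Relation.Unary.All using (All; []; _∷_)
open import Data.Nat.Base hiding (_⊔_)
open import Data.Nat.Coprimality as Coprime using (Coprime; coprime-divisor)
open import Data.Nat.Divisibility hiding (quotient)
open import Data.Nat.DivMod using (_%_; _/_; m≡m%n+[m/n]*n; m%n<n)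
open import Data.Nat.ListAction using (product)
open import Data.Nat.Induction using (<-rec)
open import Data.Nat.Primality using (Prime; prime⇒irreducible; prime⇒nonTrivial)
open import Data.Nat.Primality.Factorisation using (PrimeFactorisation; factorise)
open import Data.Nat.Properties
open import Data.Product.Base using (∃-syntax; _×_; _,_; proj₁; proj₂)
open import Data.Sum.Base as Sum using (_⊎_; inj₁; inj₂)
open import Data.Vec.Base using (Vec; []; _∷_; replicate)
open import Function.Base using (_∘_)
open import Function.Bundles using (Bijection; Equivalence; _⇔_; mk⇔)
open import Level using (Level; _⊔_)
open import Relation.Binary.Bundles using (Setoid)
open import Relation.Binary.Definitions using (Decidable; tri<; tri≈; tri>)
open import Relation.Binary.PropositionalEquality as ≡ using (_≡_; _≢_)
import Relation.Binary.Reasoning.Setoid as SetoidReasoning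
open import Relation.Nullary using (¬_; Dec; yes; no; contradiction)
open import Relation.Nullary.Decidable using (map′; _×-dec_)

private
  variable
    c ℓ : Level

-- Coprimality

-- A common divisor of `a * b` and `d` shares no factor with `a`, so it divides `b`.
coprime-*ˡ : ∀ {a b d} → Coprime a d → Coprime b d → Coprime (a * b) d
coprime-*ˡ {a} coprime-a coprime-b (e∣ab , e∣d) = coprime-b (e∣b , e∣d)
  where
  e∣b = coprime-divisor {n = a} (λ (f∣e , f∣a) → coprime-a (f∣a , ∣-trans f∣e e∣d)) e∣ab

coprime-∣ˡ : ∀ {a b d} → a ∣ b → Coprime b d → Coprime a d
coprime-∣ˡ a∣b coprime (e∣a , e∣d) = coprime (∣-trans e∣a a∣b , e∣d)

prime∤⇒coprime : ∀ {p n} → Prime p → p ∤ n → Coprime p n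
prime∤⇒coprime p-prime p∤n (e∣p , e∣n) with prime⇒irreducible p-prime e∣p
... | inj₁ e≡1    = e≡1
... | inj₂ ≡.refl = contradiction e∣n p∤n

coprime-∣-* : ∀ {a b k} → Coprime a b → a ∣ k → b ∣ k → a * b ∣ k
coprime-∣-* {a} {b} coprime (divides-refl q) b∣qa =
  ≡.subst (_∣ q * a) (*-comm b a) (*-monoˡ-∣ a b∣q)
  where
  b∣q = coprime-divisor (Coprime.sym coprime) (≡.subst (b ∣_) (*-comm q a) b∣qa)

-- In an abelian group, elements of nonzero orders `a` and `b` have powers of orders `d` and `e`,
-- whose product has order `d * e`. Only a strict gain over `a` is asked for, not the least common
-- multiple.
CoprimeSplit : ℕ → ℕ → Set
CoprimeSplit a b = ∃[ d ] ∃[ e ] d ∣ a × e ∣ b × Coprime d e × a < d * e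

-- A common prime factor p of a and b is cancelled and returned afterwards
-- to whichever of the two parts keeps them coprime.
∤product⇒coprimeSplit : ∀ {a ps} .{{_ : NonZero a}} → All Prime ps →
                        product ps ∤ a → CoprimeSplit a (product ps)
∤product⇒coprimeSplit []                               1∤a = contradiction (1∣ _) 1∤a
∤product⇒coprimeSplit {a} {p ∷ ps} (p-prime ∷ primes) pb∤a with p ∣? a
-- The prime `p` alone suffices here: `a * p` exceeds `a`, which is nonzero.
... | no p∤a =
  a , p , ∣-refl , m∣m*n (product ps) , Coprime.sym (prime∤⇒coprime p-prime p∤a) ,
  m<m*n a p (nonTrivial⇒n>1 p {{prime⇒nonTrivial p-prime}})
... | yes (divides-refl q)
  with d , e , d∣q , e∣b , coprime , q<de ←
    ∤product⇒coprimeSplit {q} {{m*n≢0⇒m≢0 q}} primes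
      (λ b∣q → pb∤a (≡.subst (_∣ q * p) (*-comm (product ps) p) (*-monoˡ-∣ p b∣q)))
  -- Either way `d * e` gains the factor `p` by which `a` exceeds `q`. If `p` divides `e`, it is
  -- coprime to `d`; otherwise it is coprime to `e`.
  with p ∣? e
... | yes p∣e =
  d , p * e , ∣m⇒∣m*n p d∣q , *-monoʳ-∣ p e∣b ,
  Coprime.sym (coprime-*ˡ (coprime-∣ˡ p∣e (Coprime.sym coprime)) (Coprime.sym coprime)) ,
  ≡.subst (q * p <_) (≡.trans (*-assoc d e p) (≡.cong (d *_) (*-comm e p)))
    (*-monoˡ-< p {{m*n≢0⇒n≢0 q}} q<de)
... | no p∤e =
  p * d , e , ≡.subst (_∣ q * p) (*-comm d p) (*-monoˡ-∣ p d∣q) , ∣n⇒∣m*n p e∣b ,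
  coprime-*ˡ (prime∤⇒coprime p-prime p∤e) coprime ,
  ≡.subst (q * p <_) (≡.trans (*-comm (d * e) p) (≡.sym (*-assoc p d e)))
    (*-monoˡ-< p {{m*n≢0⇒n≢0 q}} q<de)

∤⇒coprimeSplit : ∀ {a b} .{{_ : NonZero a}} .{{b≢0 : NonZero b}} → b ∤ a → CoprimeSplit a b
∤⇒coprimeSplit {a} {b} b∤a = ≡.subst (CoprimeSplit a) (≡.sym isFactorisation)
  (∤product⇒coprimeSplit factorsPrime (b∤a ∘ ≡.subst (_∣ a) (≡.sym isFactorisation)))
  where open PrimeFactorisation (factorise b)

-- Finite setoids

module _ {S : Setoid c ℓ} (finite : Finite S) where
  open Setoid S
  open Bijection (proj₂ finite)

  finite⇒decidable : Decidable _≈_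
  finite⇒decidable x y = map′ injective cong (to x Fin.≟ to y)

  -- The search runs over the indices in `Fin`; `resp` carries `P` from the chosen representative of
  -- an index to every element with that index.
  finite⇒all⊎counterexample : ∀ {p} {P : Carrier → Set p} →
                              (∀ {x y} → x ≈ y → P x → P y) → (∀ x → Dec (P x)) →
                              (∀ x → P x) ⊎ ∃[ x ] ¬ P x
  finite⇒all⊎counterexample {P = P} resp P? with Fin.all? (λ i → P? (from i))
    where
    from : Fin (proj₁ finite) → Carrier
    from i = proj₁ (strictlySurjective i)
  ... | yes all = inj₁ λ x → resp (injective (proj₂ (strictlySurjective (to x)))) (all (to x))
  ... | no ¬all with i , ¬P ← Fin.¬∀⟶∃¬ _ _ (λ i → P? _) ¬all = inj₂ (_ , ¬P)

-- Orders of elements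

module _ (A : AbelianGroup c ℓ) where
  open AbelianGroup A
  open Powers commutativeMonoid using (×-congʳ; ×-congˡ; ×-homo-+; ×-assocˡ; ×-distrib-+)
    renaming (_×_ to _·_)
  open GroupProperties group using (∙-cancelˡ)
  open SetoidReasoning setoid

  -- With m = 0 this says that x has infinite order.
  HasOrder : Carrier → ℕ → Set ℓ
  HasOrder x m = ∀ k → k · x ≈ ε ⇔ m ∣ k

  ·-ε : ∀ k → k · ε ≈ ε
  ·-ε zero    = refl
  ·-ε (suc k) = trans (identityˡ (k · ε)) (·-ε k)

  ·-annihilates-* : ∀ {x m} k → m · x ≈ ε → (k * m) · x ≈ ε
  ·-annihilates-* {x} {m} k mx≈ε = begin
    (k * m) · x  ≈⟨ ×-assocˡ x k m ⟨
    k · (m · x)  ≈⟨ ×-congʳ k mx≈ε ⟩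
    k · ε        ≈⟨ ·-ε k ⟩
    ε            ∎

  ·-annihilates-∣ : ∀ {x m k} → m ∣ k → m · x ≈ ε → k · x ≈ ε
  ·-annihilates-∣ (divides-refl q) = ·-annihilates-* q

  ·-cancel-< : ∀ {x i j} → i < j → i · x ≈ j · x → (j ∸ i) · x ≈ ε
  ·-cancel-< {x} {i} {j} i<j ix≈jx = ∙-cancelˡ (i · x) _ _ (begin
    i · x ∙ (j ∸ i) · x  ≈⟨ ×-homo-+ x i (j ∸ i) ⟨
    (i + (j ∸ i)) · x    ≈⟨ ×-congˡ (m+[n∸m]≡n (<⇒≤ i<j)) ⟩
    j · x                ≈⟨ ix≈jx ⟨
    i · x                ≈⟨ identityʳ (i · x) ⟨
    i · x ∙ ε            ∎)

  hasOrder-ε : HasOrder ε 1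
  hasOrder-ε k = mk⇔ (λ _ → 1∣ k) (λ _ → ·-ε k)

  hasOrder-· : ∀ {x k m} .{{_ : NonZero k}} → HasOrder x (k * m) → HasOrder (k · x) m
  hasOrder-· {x} {k} {m} ord j = mk⇔
    (λ eq → *-cancelˡ-∣ k (≡.subst (k * m ∣_) (*-comm j k)
      (Equivalence.to (ord (j * k)) (trans (sym (×-assocˡ x j k)) eq))))
    (λ m∣j → trans (×-assocˡ x j k) (Equivalence.from (ord (j * k))
      (≡.subst (k * m ∣_) (*-comm k j) (*-monoʳ-∣ k m∣j))))

  hasOrder-∣ : ∀ {x a d} .{{_ : NonZero a}} → HasOrder x a → d ∣ a → ∃[ y ] HasOrder y d
  hasOrder-∣ {x} ord (divides-refl q) = q · x , hasOrder-· {{m*n≢0⇒m≢0 q}} ord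

  -- Raising x ∙ y to a multiple of b kills y, so a divides k b whenever
  -- (x ∙ y) ^ k = ε.
  ∙-annihilated⇒∣ : ∀ {x y a b} k → Coprime a b → HasOrder x a → b · y ≈ ε →
                    k · (x ∙ y) ≈ ε → a ∣ k
  ∙-annihilated⇒∣ {x} {y} {a} {b} k coprime ord by≈ε eq =
    coprime-divisor coprime (Equivalence.to (ord (b * k)) (begin
      (b * k) · x                  ≈⟨ identityʳ _ ⟨
      (b * k) · x ∙ ε              ≈⟨ ∙-congˡ (·-annihilates-∣ {y} {b} (m∣m*n k) by≈ε) ⟨
      (b * k) · x ∙ (b * k) · y    ≈⟨ ×-distrib-+ x y (b * k) ⟨
      (b * k) · (x ∙ y)            ≈⟨ ·-annihilates-* b eq ⟩
      ε                            ∎))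

  hasOrder-annihilates : ∀ {x m} → HasOrder x m → m · x ≈ ε
  hasOrder-annihilates {m = m} ord = Equivalence.from (ord m) ∣-refl

  -- Both `a` and `b` divide every annihilating exponent, the second by exchanging `x` and `y`;
  -- coprimality then combines them.
  hasOrder-∙ : ∀ {x y a b} → Coprime a b → HasOrder x a → HasOrder y b →
               HasOrder (x ∙ y) (a * b)
  hasOrder-∙ {x} {y} {a} {b} coprime ord-x ord-y k = mk⇔
    (λ eq → coprime-∣-* coprime
      (∙-annihilated⇒∣ k coprime ord-x (hasOrder-annihilates ord-y) eq)
      (∙-annihilated⇒∣ k (Coprime.sym coprime) ord-y (hasOrder-annihilates ord-x)
        (trans (×-congʳ k (comm y x)) eq)))
    (λ ab∣k → begin
      k · (x ∙ y)    ≈⟨ ×-distrib-+ x y k ⟩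
      k · x ∙ k · y  ≈⟨ ∙-cong (Equivalence.from (ord-x k) (m*n∣⇒m∣ a b ab∣k))
                               (Equivalence.from (ord-y k) (m*n∣⇒n∣ a b ab∣k)) ⟩
      ε ∙ ε          ≈⟨ identityˡ ε ⟩
      ε              ∎)

  -- Otherwise `j ∸ i` would be a positive multiple of `m` smaller than `m`.
  hasOrder⇒distinct : ∀ {x m i j} → HasOrder x m → i < j → j < m → ¬ i · x ≈ j · x
  hasOrder⇒distinct {i = i} {j} ord i<j j<m eq =
    <⇒≱ (≤-<-trans (m∸n≤m j i) j<m)
        (∣⇒≤ {{>-nonZero (m<n⇒0<n∸m i<j)}} (Equivalence.to (ord (j ∸ i)) (·-cancel-< i<j eq)))

  hasOrder⇒·-injective : ∀ {x m} → HasOrder x m → ∀ {i j : Fin m} →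
                         toℕ i · x ≈ toℕ j · x → i ≡ j
  hasOrder⇒·-injective ord {i} {j} eq with <-cmp (toℕ i) (toℕ j)
  ... | tri< i<j _ _ = contradiction eq (hasOrder⇒distinct ord i<j (Fin.toℕ<n j))
  ... | tri≈ _ i≡j _ = Fin.toℕ-injective i≡j
  ... | tri> _ _ j<i = contradiction (sym eq) (hasOrder⇒distinct ord j<i (Fin.toℕ<n i))

  -- The remainder of an annihilating exponent modulo `m` annihilates too, so minimality makes it
  -- zero.
  leastAnnihilator⇒hasOrder : ∀ {x m} .{{_ : NonZero m}} → m · x ≈ ε →
                              (∀ {k} → k < m → k · x ≈ ε → k ≡ 0) → HasOrder x m
  leastAnnihilator⇒hasOrder {x} {m} mx≈ε least k = mk⇔
    (λ kx≈ε → m%n≡0⇒n∣m k m (least (m%n<n k m) (begin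
      (k % m) · x                      ≈⟨ identityʳ _ ⟨
      (k % m) · x ∙ ε                  ≈⟨ ∙-congˡ (·-annihilates-* (k / m) mx≈ε) ⟨
      (k % m) · x ∙ (k / m * m) · x    ≈⟨ ×-homo-+ x (k % m) (k / m * m) ⟨
      (k % m + k / m * m) · x          ≈⟨ ×-congˡ (m≡m%n+[m/n]*n k m) ⟨
      k · x                            ≈⟨ kx≈ε ⟩
      ε                                ∎)))
    (λ m∣k → ·-annihilates-∣ m∣k mx≈ε)

  -- Orders in a finite abelian group

  module _ (finite : Finite setoid) where
    private
      n = proj₁ finite
      open Bijection (proj₂ finite) using (to; injective)

      _≈?_ : Decidable _≈_
      _≈?_ = finite⇒decidable finite

    -- Descent: either a smaller positive exponent annihilates `x`, or `m` is the least one and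
    -- hence the order.
    annihilated⇒hasOrder : ∀ x m .{{_ : NonZero m}} → m · x ≈ ε →
                           ∃[ k ] NonZero k × HasOrder x k
    annihilated⇒hasOrder x = <-rec _ step
      where
      step : ∀ m → (∀ {k} → k < m → .{{_ : NonZero k}} → k · x ≈ ε →
                    ∃[ k ] NonZero k × HasOrder x k) →
             .{{_ : NonZero m}} → m · x ≈ ε → ∃[ k ] NonZero k × HasOrder x k
      step m@(suc _) rec mx≈ε
        with anyUpTo? (λ k → nonZero? k ×-dec (k · x) ≈? ε) m
      ... | yes (k , k<m , k≢0 , kx≈ε) = rec k<m {{k≢0}} kx≈ε
      ... | no none = m , _ , leastAnnihilator⇒hasOrder mx≈ε least
        where
        least : ∀ {k} → k < m → k · x ≈ ε → k ≡ 0
        least {zero}  _   _    = ≡.refl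
        least {suc k} k<m kx≈ε = contradiction (suc k , k<m , _ , kx≈ε) none

    finite⇒hasOrder : ∀ x → ∃[ m ] NonZero m × HasOrder x m
    finite⇒hasOrder x
      -- Among the `n + 1` powers with exponents from 0 to `n`, two coincide.
      with i , j , i<j , eq ← Fin.pigeonhole (n<1+n n) (λ i → to (toℕ i · x)) =
      annihilated⇒hasOrder x (toℕ j ∸ toℕ i) {{>-nonZero (m<n⇒0<n∸m i<j)}}
        (·-cancel-< i<j (injective eq))

    hasOrder⇒≤size : ∀ {x m} → HasOrder x m → m ≤ n
    hasOrder⇒≤size {x} ord =
      Fin.injective⇒≤ {f = λ i → to (toℕ i · x)} (hasOrder⇒·-injective ord ∘ injective)

    increaseOrder : ∀ {x y a} .{{_ : NonZero a}} → HasOrder x a → ¬ a · y ≈ ε →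
                    ∃[ z ] ∃[ b ] a < b × HasOrder z b
    increaseOrder {x} {y} {a} ord-x ay≉ε
      -- The order `b` of `y` cannot divide `a`, because `a · y` is not `ε`.
      with b , b≢0 , ord-y ← finite⇒hasOrder y
      with d , e , d∣a , e∣b , coprime , a<de ←
             ∤⇒coprimeSplit {{b≢0 = b≢0}} (ay≉ε ∘ Equivalence.from (ord-y a))
      with x′ , ord-x′ ← hasOrder-∣ ord-x d∣a
      with y′ , ord-y′ ← hasOrder-∣ {{b≢0}} ord-y e∣b =
      x′ ∙ y′ , d * e , a<de , hasOrder-∙ coprime ord-x′ ord-y′

    annihilates⊎increaseOrder : ∀ {x a} .{{_ : NonZero a}} → HasOrder x a →
                                (∀ y → a · y ≈ ε) ⊎ ∃[ z ] ∃[ b ] a < b × HasOrder z b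
    annihilates⊎increaseOrder {a = a} ord =
      Sum.map₂ (λ (y , ay≉ε) → increaseOrder ord ay≉ε)
        (finite⇒all⊎counterexample finite (λ x≈y ax≈ε → trans (×-congʳ a (sym x≈y)) ax≈ε)
          (λ y → (a · y) ≈? ε))

    exponent-attained : ∃[ g ] ∃[ m ] NonZero m × HasOrder g m × ∀ x → m · x ≈ ε
    exponent-attained = search n ε 1 hasOrder-ε (n<1+n n)
      where
      -- Each improvement raises `m` by at least one and lowers `k` by one, which preserves
      -- `n < m + k`; at `k = 0` the order would exceed the size `n` of the group.
      search : ∀ k g m .{{_ : NonZero m}} → HasOrder g m → n < m + k →
               ∃[ g ] ∃[ m ] NonZero m × HasOrder g m × ∀ x → m · x ≈ ε
      search zero    g m ord n<m =
        contradiction (≡.subst (n <_) (+-identityʳ m) n<m) (≤⇒≯ (hasOrder⇒≤size {g} {m} ord))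
      search (suc k) g m ord n<m+k = continue (annihilates⊎increaseOrder {g} {m} ord)
        where
        continue : (∀ y → m · y ≈ ε) ⊎ (∃[ z ] ∃[ b ] m < b × HasOrder z b) →
                   ∃[ g ] ∃[ m ] NonZero m × HasOrder g m × ∀ x → m · x ≈ ε
        continue (inj₁ all) = g , m , ≢-nonZero (≢-nonZero⁻¹ m) , ord , all
        continue (inj₂ (z , b , m<b , ord′)) =
          search k z b {{>-nonZero (≤-<-trans z≤n m<b)}} ord′
            (<-≤-trans n<m+k (≤-trans (≤-reflexive (+-suc m k)) (+-monoˡ-≤ k m<b)))

-- Monic polynomials

module MonicPolynomial (R : CommutativeSemiring c ℓ) where
  open CommutativeSemiring R renaming (_+_ to _⊕_; _*_ to _⊛_)
  open SetoidReasoning setoid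
  open SemiringSolver R using (solve; _:=_; _:+_; _:*_)

  -- The entries are the coefficients below the leading 1, lowest degree first.
  eval : ∀ {n} → Vec Carrier n → Carrier → Carrier
  eval []       x = 1#
  eval (a ∷ as) x = a ⊕ x ⊛ eval as x

  -- Synthetic division by X - r with the remainder dropped: the coefficients are the Horner values
  -- at `r` of the successive tails, and the leading 1 stays implicit.
  quotient : ∀ {n} → Carrier → Vec Carrier (suc n) → Vec Carrier n
  quotient r (_ ∷ [])         = []
  quotient r (_ ∷ as@(_ ∷ _)) = eval as r ∷ quotient r as

  -- f(x) − f(r) = (x − r) q(x) with both sides moved so that no subtraction occurs.
  eval-quotient : ∀ {n} r (as : Vec Carrier (suc n)) x →
                  eval as x ⊕ r ⊛ eval (quotient r as) x ≈
                  eval as r ⊕ x ⊛ eval (quotient r as) x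
  eval-quotient r (a ∷ [])         x =
    solve 3 (λ a r x → (a :+ x) :+ r := (a :+ r) :+ x) refl a (r ⊛ 1#) (x ⊛ 1#)
  eval-quotient r (a ∷ as@(_ ∷ _)) x = begin
    (a ⊕ x ⊛ A) ⊕ r ⊛ (B ⊕ x ⊛ Q)  ≈⟨ solve 6 (λ a x A r B Q →
      (a :+ x :* A) :+ r :* (B :+ x :* Q) := (a :+ r :* B) :+ x :* (A :+ r :* Q))
      refl a x A r B Q ⟩
    (a ⊕ r ⊛ B) ⊕ x ⊛ (A ⊕ r ⊛ Q)  ≈⟨ +-congˡ (*-congˡ (eval-quotient r as x)) ⟩
    (a ⊕ r ⊛ B) ⊕ x ⊛ (B ⊕ x ⊛ Q)  ∎
    where
    A = eval as x
    B = eval as r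
    Q = eval (quotient r as) x

-- Roots of polynomials over a field

module _ (F : Field c ℓ) where
  open Field F renaming
    ( _+_ to _⊕_; _*_ to _⊛_; -_ to ⊖_; *-assoc to ⊛-assoc; *-comm to ⊛-comm
    ; *-identityʳ to ⊛-identityʳ; +-identityˡ to ⊕-identityˡ )
  open MonicPolynomial commutativeSemiring
  open GroupProperties +-group using (∙-cancelˡ)
  open SetoidReasoning setoid

  *-cancelʳ-≉0 : ∀ {x y z} → ¬ z ≈ 0# → x ⊛ z ≈ y ⊛ z → x ≈ y
  *-cancelʳ-≉0 {x} {y} {z} z≉0 xz≈yz with u , _ , zu≈1 ← ≉0⇒invertible z z≉0 = begin
    x            ≈⟨ expand x ⟩
    (x ⊛ z) ⊛ u  ≈⟨ *-congʳ xz≈yz ⟩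
    (y ⊛ z) ⊛ u  ≈⟨ expand y ⟨
    y            ∎
    where
    expand : ∀ w → w ≈ (w ⊛ z) ⊛ u
    expand w = begin
      w            ≈⟨ ⊛-identityʳ w ⟨
      w ⊛ 1#       ≈⟨ *-congˡ zu≈1 ⟨
      w ⊛ (z ⊛ u)  ≈⟨ ⊛-assoc w z u ⟨
      (w ⊛ z) ⊛ u  ∎

  -- Induction on the degree: after division by X - r for the first root r, the other roots are
  -- roots of the quotient. In degree 0 the polynomial is the constant 1.
  roots≤degree : Decidable _≈_ → ∀ {n} (as : Vec Carrier n) (root : Fin (suc n) → Carrier) →
                 (∀ {i j} → root i ≈ root j → i ≡ j) → ¬ (∀ i → eval as (root i) ≈ 0#)
  roots≤degree _≈?_ []         root inj zeros = 0≉1 (sym (zeros Fin.zero))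
  roots≤degree _≈?_ as@(_ ∷ _) root inj zeros =
    roots≤degree _≈?_ (quotient r as) (root ∘ Fin.suc) (Fin.suc-injective ∘ inj) zeros′
    where
    r = root Fin.zero
    zeros′ : ∀ i → eval (quotient r as) (root (Fin.suc i)) ≈ 0#
    zeros′ i with eval (quotient r as) (root (Fin.suc i)) ≈? 0#
    ... | yes q≈0 = q≈0
    -- As `x` and `r` are both roots, the division identity leaves `r ⊛ q ≈ x ⊛ q`; cancelling a
    -- nonzero `q` would identify two distinct roots.
    ... | no  q≉0 = contradiction (inj (*-cancelʳ-≉0 q≉0 (∙-cancelˡ _ _ _ (begin
      0# ⊕ r ⊛ q            ≈⟨ +-congʳ (zeros (Fin.suc i)) ⟨
      eval as x ⊕ r ⊛ q     ≈⟨ eval-quotient r as x ⟩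
      eval as r ⊕ x ⊛ q     ≈⟨ +-congʳ (zeros Fin.zero) ⟩
      0# ⊕ x ⊛ q            ∎)))) λ ()
      where
      x = root (Fin.suc i)
      q = eval (quotient r as) x

  -- The multiplicative group

  private
    module F* = Group (multiplicativeGroup F)
    open MonoidPowers F*.monoid using () renaming (_×_ to _·_)

  multiplicativeAbelianGroup : AbelianGroup (c ⊔ ℓ) ℓ
  multiplicativeAbelianGroup = record
    { isAbelianGroup = record
      { isGroup = F*.isGroup
      ; comm    = λ (x , _) (y , _) → ⊛-comm x y
      }
    }

  -- Punching the index of `0#` out of `Fin (suc n)` leaves `n` indices for the nonzero elements.
  multiplicativeGroup-finite : Finite setoid → Finite F*.setoid
  multiplicativeGroup-finite (zero , bij) = contradiction (Bijection.to bij 0#) λ ()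
  multiplicativeGroup-finite (suc n , bij) = n , record
    { to        = λ (x , x≉0) → punchOut (to0≢to x≉0)
    ; cong      = λ x≈y → Fin.punchOut-cong (to 0#) (cong x≈y)
    ; bijective =
        (λ {(_ , x≉0)} {(_ , y≉0)} eq →
          injective (Fin.punchOut-injective (to0≢to x≉0) (to0≢to y≉0) eq)) ,
        (λ i → let x , to-x≡ = strictlySurjective (punchIn (to 0#) i) in
          (x , λ x≈0 → Fin.punchInᵢ≢i (to 0#) i (≡.trans (≡.sym to-x≡) (cong x≈0))) ,
          λ z≈x → ≡.trans (Fin.punchOut-cong (to 0#) (≡.trans (cong z≈x) to-x≡))
                          (Fin.punchOut-punchIn (to 0#)))
    }
    where
    open Bijection bij
    to0≢to : ∀ {x} → ¬ x ≈ 0# → to 0# ≢ to x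
    to0≢to x≉0 eq = x≉0 (injective (≡.sym eq))

  -- With its implicit leading 1, the vector of `k` zeros encodes X ^ k.
  eval-replicate-0 : ∀ k x → eval (replicate k 0#) (proj₁ x) ≈ proj₁ (k · x)
  eval-replicate-0 zero    x = refl
  eval-replicate-0 (suc k) x = trans (⊕-identityˡ _) (*-congˡ (eval-replicate-0 k x))

  rootsOfUnity≤exponent : Decidable _≈_ → ∀ {m} .{{_ : NonZero m}}
                          (root : Fin (suc m) → F*.Carrier) →
                          (∀ {i j} → root i F*.≈ root j → i ≡ j) →
                          ¬ (∀ i → m · root i F*.≈ F*.ε)
  rootsOfUnity≤exponent _≈?_ {suc m} root inj unity =
    -- This vector encodes X ^ (m + 1) - 1, the exponent having been matched as `suc m`.
    roots≤degree _≈?_ (⊖ 1# ∷ replicate m 0#) (proj₁ ∘ root) inj λ i → begin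
      ⊖ 1# ⊕ proj₁ (root i) ⊛ eval (replicate m 0#) (proj₁ (root i))
        ≈⟨ +-congˡ (*-congˡ (eval-replicate-0 m (root i))) ⟩
      ⊖ 1# ⊕ proj₁ (suc m · root i)  ≈⟨ +-congˡ (unity i) ⟩
      ⊖ 1# ⊕ 1#                      ≈⟨ -‿inverseˡ 1# ⟩
      0#                             ∎

  -- If x were not a power of g, then x and the m powers of g would be m + 1
  -- distinct roots of X ^ m − 1.
  order≡exponent⇒generates : Decidable _≈_ → ∀ {g m} .{{_ : NonZero m}} →
                             HasOrder multiplicativeAbelianGroup g m →
                             (∀ x → m · x F*.≈ F*.ε) →
                             ∀ x → ∃[ k ] power (multiplicativeGroup F) g k F*.≈ x
  order≡exponent⇒generates _≈?_ {g} {m} ord annihilates x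
    with Fin.any? {n = m} (λ i → proj₁ (toℕ i · g) ≈? proj₁ x)
  ... | yes (i , eq) = + toℕ i , eq
  ... | no  x∉⟨g⟩    = contradiction (annihilates ∘ root)
                         (rootsOfUnity≤exponent _≈?_ root root-injective)
    where
    root : Fin (suc m) → F*.Carrier
    root Fin.zero    = x
    root (Fin.suc i) = toℕ i · g

    root-injective : ∀ {i j} → root i F*.≈ root j → i ≡ j
    root-injective {Fin.zero}  {Fin.zero}  _  = ≡.refl
    root-injective {Fin.zero}  {Fin.suc j} eq = contradiction (j , sym eq) x∉⟨g⟩
    root-injective {Fin.suc i} {Fin.zero}  eq = contradiction (i , eq) x∉⟨g⟩
    root-injective {Fin.suc i} {Fin.suc j} eq =
      ≡.cong Fin.suc (hasOrder⇒·-injective multiplicativeAbelianGroup ord eq)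

theorem1p6 : ∀ {c ℓ} (F : Field c ℓ) → Finite (Field.setoid F) → Cyclic (multiplicativeGroup F)
theorem1p6 F finite =
  let g , m , m≢0 , ord , annihilates =
        exponent-attained (multiplicativeAbelianGroup F) (multiplicativeGroup-finite F finite)
  in g , order≡exponent⇒generates F (finite⇒decidable finite) {{m≢0}} ord annihilates
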